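{- Let $\Gamma=(V_\Gamma,E_\Gamma,s,t)$ be a finite strongly connected $k$-out graph, and let $H$ be a nontrivial finite group. Assume that $|V_\Gamma|\ge d(H)$. Let $\Gamma^\sharp$ be the graph obtained from $\Gamma$ by adding exactly one loop at every vertex. Then $\Gamma^\sharp$ is a strongly connected $(k+1)$-out graph, and there exist a finite strongly connected $(k+1)$-out graph $G$ and a graph congruence $\rho$ on $G$ such that \[ G/\rho\cong \Gamma^\sharp,\qquad \operatorname{Aut}(G)/\operatorname{Aut}_E(G)\cong H, \] and $G$ is not totally synchronizing.
   Context: A graph is a finite directed multigraph $G=(V,E,s,t)$ with source and target maps $s,t:E\to V$ (loops and parallel edges allowed). It is $k$-out if every vertex has exactly $k$ outgoing edges. An isomorphism of graphs is a pair of bijections on vertices and on edges commuting with $s$ and $t$; $\operatorname{Aut}(G)$ is the group of automorphisms $\varphi=(\varphi_v,\varphi_e)$, and $\operatorname{Aut}_E(G)=\{\varphi\in\operatorname{Aut}(G):\varphi_v=\mathrm{id}_{V}\}$ is its (normal) subgroup of automorphisms fixing every vertex. $d(H)$ denotes the minimal size of a generating set of the group $H$. Given an equivalence relation $\rho$ on $V(G)$, the quotient $G/\rho$ has vertex set $V(G)/\rho$ and, for each pair of classes $C,D$, exactly $\max_{p\in C}|\{e\in E: s(e)=p,\ t(e)\in D\}|$ parallel edges from $C$ to $D$. For a $k$-out graph $G$, $\rho$ is a (graph) congruence if $G/\rho$ is again $k$-out; equivalently, for all classes $C,D$ all vertices of $C$ have the same number of outgoing edges ending in $D$. A coloring of a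 $k$-out graph $G$ is a map $\chi:E\to[k]=\{1,\dots,k\}$ whose restriction to the set of outgoing edges of each vertex is a bijection onto $[k]$. It defines the deterministic complete automaton $\chi(G)=(V,[k],\delta_\chi)$, where $\delta_\chi(v,a)=t(e)$ for the unique edge $e$ with $s(e)=v$, $\chi(e)=a$. The automaton is synchronizing if there is a word $w\in[k]^*$ with $|V\cdot w|=1$. $G$ is totally synchronizing if $\chi(G)$ is synchronizing for every coloring $\chi$ of $G$. -}

module Defs where

open import Algebra.Bundles using (Group)
open import Algebra.Morphism.Structures using (module GroupMorphisms)
import Algebra.Properties.Group as GroupProperties
open import Data.Fin.Base using (Fin; toℕ)
open import Data.Fin.Properties using () renaming (_≟_ to _≟ᶠ_)
open import Data.List.Base using (List; []; _∷_; map; filter; length; allFin)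
open import Data.List.Extrema.Nat using (max)
open import Data.Nat.Base using (ℕ; _≤_)
open import Data.Product using (Σ; ∃; ∃!; _×_; _,_; proj₁; proj₂)
open import Data.Product.Relation.Binary.Pointwise.NonDependent using (_×ₛ_)
open import Data.Sum.Base using (inj₁; inj₂; [_,_])
open import Data.Sum.Relation.Binary.Pointwise using (_⊎ₛ_; inj₁; inj₂)
open import Function.Bundles using (Func; Inverse)
open import Function.Definitions using (Injective; Bijective)
import Function.Construct.Composition as Comp
import Function.Construct.Identity as Id
import Function.Construct.Symmetry as Symm
open import Function.Properties.Inverse using (Inverse⇒Injection)
open import Level using (Level; 0ℓ; _⊔_) renaming (suc to lsuc)
open import Relation.Binary.Bundles using (Setoid)
open import Relation.Binary.Core using (Rel; _⇒_)
open import Relation.Binary.Definitions using (Decidable)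
open import Relation.Binary.Structures using (IsDecEquivalence)
import Relation.Binary.Construct.On as On
open import Relation.Binary.PropositionalEquality as ≡ using (_≡_)
import Relation.Binary.Reasoning.Setoid as SetoidReasoning
open import Relation.Nullary.Decidable using (via-injection; _×-dec_)
open import Relation.Nullary.Negation using (¬_)

infix  4 _≅_ _≅ᴳ_
infixl 7 _/ᴳ_
infix  8 _♯

private
  variable
    a c ℓ p : Level

-- Sets are setoids throughout, so that quotients can be formed by enlarging
-- the equality.

FinSetoid : ℕ → Setoid 0ℓ 0ℓ
FinSetoid n = ≡.setoid (Fin n)

HasSize : Setoid a ℓ → ℕ → Set (a ⊔ ℓ)
HasSize S n = Inverse S (FinSetoid n)

Finite : Setoid a ℓ → Set (a ⊔ ℓ)
Finite S = ∃ (HasSize S)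

module Enumerated {S : Setoid a ℓ} (fin : Finite S) where
  open Setoid S using (Carrier; _≈_)

  elements : List Carrier
  elements = map (Inverse.from (proj₂ fin)) (allFin (proj₁ fin))

  _≟_ : Decidable _≈_
  _≟_ = via-injection (Inverse⇒Injection (proj₂ fin)) _≟ᶠ_

record Graph : Set₁ where
  field
    V E : Setoid 0ℓ 0ℓ
    s t : Func E V

  module V = Setoid V
  module E = Setoid E
  open Func s public using () renaming (to to src; cong to src-cong)
  open Func t public using () renaming (to to tgt; cong to tgt-cong)

  Out : V.Carrier → Setoid 0ℓ 0ℓ
  Out v = On.setoid {B = Σ E.Carrier (λ e → src e V.≈ v)} E proj₁

record FiniteGraph (G : Graph) : Set where
  open Graph G
  field
    V-finite : Finite V
    E-finite : Finite E

  ∣V∣ : ℕ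
  ∣V∣ = proj₁ V-finite

IsOut : ℕ → Graph → Set
IsOut k G = ∀ v → HasSize (Out v) k
  where open Graph G

data Path (G : Graph) : (u v : Graph.V.Carrier G) → Set where
  nil  : ∀ {u v} → Graph.V._≈_ G u v → Path G u v
  cons : ∀ {u v} e → Graph.V._≈_ G (Graph.src G e) u →
         Path G (Graph.tgt G e) v → Path G u v

StronglyConnected : Graph → Set
StronglyConnected G = ∀ u v → Path G u v

_♯ : Graph → Graph
Γ ♯ = record
  { V = V
  ; E = E ⊎ₛ V
  ; s = record { to = [ src , (λ v → v) ]
               ; cong = λ { (inj₁ eq) → src-cong eq ; (inj₂ eq) → eq } }
  ; t = record { to = [ tgt , (λ v → v) ]
               ; cong = λ { (inj₁ eq) → tgt-cong eq ; (inj₂ eq) → eq } }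
  }
  where open Graph Γ

record _≅_ (G H : Graph) : Set where
  private
    module G = Graph G
    module H = Graph H
  field
    φᵥ : Inverse G.V H.V
    φₑ : Inverse G.E H.E

  open Inverse φᵥ public using ()
    renaming (to to onV; from to onV⁻¹; to-cong to onV-cong; from-cong to onV⁻¹-cong)
  open Inverse φₑ public using ()
    renaming (to to onE; from to onE⁻¹; to-cong to onE-cong; from-cong to onE⁻¹-cong)

  field
    commutes-s : ∀ e → H.src (onE e) H.V.≈ onV (G.src e)
    commutes-t : ∀ e → H.tgt (onE e) H.V.≈ onV (G.tgt e)

≅-refl : ∀ {G} → G ≅ G
≅-refl {G} = record
  { φᵥ = Id.inverse V
  ; φₑ = Id.inverse E
  ; commutes-s = λ _ → V.refl
  ; commutes-t = λ _ → V.refl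
  }
  where open Graph G

≅-sym : ∀ {G H} → G ≅ H → H ≅ G
≅-sym {G} {H} φ = record
  { φᵥ = Symm.inverse φᵥ
  ; φₑ = Symm.inverse φₑ
  ; commutes-s = λ e → G.V.sym (Inverse.inverseʳ φᵥ
      (H.V.trans (H.src-cong (H.E.sym (Inverse.strictlyInverseˡ φₑ e))) (commutes-s _)))
  ; commutes-t = λ e → G.V.sym (Inverse.inverseʳ φᵥ
      (H.V.trans (H.tgt-cong (H.E.sym (Inverse.strictlyInverseˡ φₑ e))) (commutes-t _)))
  }
  where
  open _≅_ φ
  module G = Graph G
  module H = Graph H

≅-trans : ∀ {G H K} → G ≅ H → H ≅ K → G ≅ K
≅-trans {K = K} φ ψ = record
  { φᵥ = Comp.inverse φ.φᵥ ψ.φᵥ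
  ; φₑ = Comp.inverse φ.φₑ ψ.φₑ
  ; commutes-s = λ e → V.trans (ψ.commutes-s _) (ψ.onV-cong (φ.commutes-s e))
  ; commutes-t = λ e → V.trans (ψ.commutes-t _) (ψ.onV-cong (φ.commutes-t e))
  }
  where
  open Graph K
  module φ = _≅_ φ
  module ψ = _≅_ ψ

Aut : Graph → Group 0ℓ 0ℓ
Aut G = record
  { Carrier = G ≅ G
  ; _≈_ = λ φ ψ → (∀ v → onV φ v V.≈ onV ψ v) × (∀ e → onE φ e E.≈ onE ψ e)
  ; _∙_ = λ φ ψ → ≅-trans ψ φ
  ; ε = ≅-refl
  ; _⁻¹ = ≅-sym
  ; isGroup = record
    { isMonoid = record
      { isSemigroup = record
        { isMagma = record
          { isEquivalence = record
            { refl = (λ _ → V.refl) , (λ _ → E.refl)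
            ; sym = λ (p , q) → (λ v → V.sym (p v)) , (λ e → E.sym (q e))
            ; trans = λ (p , q) (p′ , q′) →
                (λ v → V.trans (p v) (p′ v)) , (λ e → E.trans (q e) (q′ e))
            }
          ; ∙-cong = λ {φ} {_} {_} {ψ′} (p , q) (p′ , q′) →
              (λ v → V.trans (onV-cong φ (p′ v)) (p (onV ψ′ v))) ,
              (λ e → E.trans (onE-cong φ (q′ e)) (q (onE ψ′ e)))
          }
        ; assoc = λ _ _ _ → (λ _ → V.refl) , (λ _ → E.refl)
        }
      ; identity = (λ _ → (λ _ → V.refl) , (λ _ → E.refl))
                 , (λ _ → (λ _ → V.refl) , (λ _ → E.refl))
      }
    ; inverse =
        (λ φ → Inverse.strictlyInverseʳ (φᵥ φ) , Inverse.strictlyInverseʳ (φₑ φ))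
      , (λ φ → Inverse.strictlyInverseˡ (φᵥ φ) , Inverse.strictlyInverseˡ (φₑ φ))
    ; ⁻¹-cong = λ {φ} {ψ} (p , q) →
        (λ v → V.sym (Inverse.inverseʳ (φᵥ ψ)
          (V.trans (V.sym (Inverse.strictlyInverseˡ (φᵥ φ) v)) (p (onV⁻¹ φ v)))))
      , (λ e → E.sym (Inverse.inverseʳ (φₑ ψ)
          (E.trans (E.sym (Inverse.strictlyInverseˡ (φₑ φ) e)) (q (onE⁻¹ φ e)))))
    }
  }
  where
  open Graph G
  open _≅_

record NormalSubgroup (G : Group c ℓ) (p : Level) : Set (c ⊔ ℓ ⊔ lsuc p) where
  open Group G
  field
    Member  : Carrier → Set p
    resp    : ∀ {x y} → x ≈ y → Member x → Member y
    ε-mem   : Member ε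
    ∙-mem   : ∀ {x y} → Member x → Member y → Member (x ∙ y)
    ⁻¹-mem  : ∀ {x} → Member x → Member (x ⁻¹)
    normal  : ∀ g {x} → Member x → Member (g ∙ x ∙ g ⁻¹)

_/ᴳ_ : (G : Group c ℓ) → NormalSubgroup G p → Group c p
G /ᴳ N = record
  { Carrier = Carrier
  ; _≈_ = λ x y → Member (x ∙ y ⁻¹)
  ; _∙_ = _∙_
  ; ε = ε
  ; _⁻¹ = _⁻¹
  ; isGroup = record
    { isMonoid = record
      { isSemigroup = record
        { isMagma = record
          { isEquivalence = record
            { refl = ≈⇒∼ refl
            ; sym = λ {x} {y} m → resp (swap x y) (⁻¹-mem m)
            ; trans = λ {x} {y} {z} m m′ → resp (cancel x y (z ⁻¹)) (∙-mem m m′)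
            }
          ; ∙-cong = λ {x} {y} {u} {v} m m′ →
              resp (product x y u v) (∙-mem (normal x m′) m)
          }
        ; assoc = λ x y z → ≈⇒∼ (assoc x y z)
        }
      ; identity = (λ x → ≈⇒∼ (identityˡ x)) , (λ x → ≈⇒∼ (identityʳ x))
      }
    ; inverse = (λ x → ≈⇒∼ (inverseˡ x)) , (λ x → ≈⇒∼ (inverseʳ x))
    ; ⁻¹-cong = λ {x} {y} m → resp (inv x y) (normal (x ⁻¹) (⁻¹-mem m))
    }
  }
  where
  open Group G
  open NormalSubgroup N
  open GroupProperties G
  open SetoidReasoning setoid

  ≈⇒∼ : ∀ {x y} → x ≈ y → Member (x ∙ y ⁻¹)
  ≈⇒∼ eq = resp (sym (x≈y⇒x∙y⁻¹≈ε eq)) ε-mem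

  swap : ∀ x y → (x ∙ y ⁻¹) ⁻¹ ≈ y ∙ x ⁻¹
  swap x y = trans (⁻¹-anti-homo-∙ x (y ⁻¹)) (∙-congʳ (⁻¹-involutive y))

  cancel : ∀ x y z → (x ∙ y ⁻¹) ∙ (y ∙ z) ≈ x ∙ z
  cancel x y z = begin
    (x ∙ y ⁻¹) ∙ (y ∙ z)  ≈⟨ assoc (x ∙ y ⁻¹) y z ⟨
    ((x ∙ y ⁻¹) ∙ y) ∙ z  ≈⟨ ∙-congʳ (//-rightDividesˡ y x) ⟩
    x ∙ z                 ∎

  product : ∀ x y u v → (x ∙ (u ∙ v ⁻¹) ∙ x ⁻¹) ∙ (x ∙ y ⁻¹) ≈ (x ∙ u) ∙ (y ∙ v) ⁻¹
  product x y u v = begin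
    (x ∙ (u ∙ v ⁻¹) ∙ x ⁻¹) ∙ (x ∙ y ⁻¹)  ≈⟨ cancel (x ∙ (u ∙ v ⁻¹)) x (y ⁻¹) ⟩
    (x ∙ (u ∙ v ⁻¹)) ∙ y ⁻¹               ≈⟨ ∙-congʳ (assoc x u (v ⁻¹)) ⟨
    ((x ∙ u) ∙ v ⁻¹) ∙ y ⁻¹               ≈⟨ assoc (x ∙ u) (v ⁻¹) (y ⁻¹) ⟩
    (x ∙ u) ∙ (v ⁻¹ ∙ y ⁻¹)               ≈⟨ ∙-congˡ (⁻¹-anti-homo-∙ y v) ⟨
    (x ∙ u) ∙ (y ∙ v) ⁻¹                  ∎

  inv : ∀ x y → x ⁻¹ ∙ (x ∙ y ⁻¹) ⁻¹ ∙ x ⁻¹ ⁻¹ ≈ x ⁻¹ ∙ y ⁻¹ ⁻¹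
  inv x y = begin
    x ⁻¹ ∙ (x ∙ y ⁻¹) ⁻¹ ∙ x ⁻¹ ⁻¹  ≈⟨ ∙-cong (∙-congˡ (swap x y)) (⁻¹-involutive x) ⟩
    x ⁻¹ ∙ (y ∙ x ⁻¹) ∙ x           ≈⟨ assoc (x ⁻¹) (y ∙ x ⁻¹) x ⟩
    x ⁻¹ ∙ (y ∙ x ⁻¹ ∙ x)           ≈⟨ ∙-congˡ (//-rightDividesˡ x y) ⟩
    x ⁻¹ ∙ y                        ≈⟨ ∙-congˡ (⁻¹-involutive y) ⟨
    x ⁻¹ ∙ y ⁻¹ ⁻¹                  ∎

_≅ᴳ_ : ∀ {c₁ ℓ₁ c₂ ℓ₂} → Group c₁ ℓ₁ → Group c₂ ℓ₂ → Set (c₁ ⊔ ℓ₁ ⊔ c₂ ⊔ ℓ₂)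
G ≅ᴳ H = ∃ IsGroupIsomorphism
  where open GroupMorphisms (Group.rawGroup G) (Group.rawGroup H)

Nontrivial : Group c ℓ → Set (c ⊔ ℓ)
Nontrivial H = ∃ λ x → ¬ (x ≈ ε)
  where open Group H

module _ (H : Group c ℓ) where
  open Group H

  data Generated {d : ℕ} (g : Fin d → Carrier) : Carrier → Set (c ⊔ ℓ) where
    gen  : ∀ i → Generated g (g i)
    unit : Generated g ε
    mul  : ∀ {x y} → Generated g x → Generated g y → Generated g (x ∙ y)
    inv  : ∀ {x} → Generated g x → Generated g (x ⁻¹)
    resp : ∀ {x y} → x ≈ y → Generated g x → Generated g y

  HasGeneratingSetOfSize : ℕ → Set (c ⊔ ℓ)
  HasGeneratingSetOfSize d =
    ∃ λ (g : Fin d → Carrier) → Injective _≡_ _≈_ g × (∀ x → Generated g x)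

  -- IsRank d means d = d(H), the minimal size of a generating set.
  IsRank : ℕ → Set (c ⊔ ℓ)
  IsRank d = HasGeneratingSetOfSize d × (∀ m → HasGeneratingSetOfSize m → d ≤ m)

Aut-E : (G : Graph) → NormalSubgroup (Aut G) 0ℓ
Aut-E G = record
  { Member = λ φ → ∀ v → onV φ v V.≈ v
  ; resp = λ (p , _) m v → V.trans (V.sym (p v)) (m v)
  ; ε-mem = λ _ → V.refl
  ; ∙-mem = λ {φ} m m′ v → V.trans (onV-cong φ (m′ v)) (m v)
  ; ⁻¹-mem = λ {φ} m v → Inverse.inverseʳ (φᵥ φ) (V.sym (m v))
  ; normal = λ φ m v →
      V.trans (onV-cong φ (m (onV⁻¹ φ v))) (Inverse.strictlyInverseˡ (φᵥ φ) v)
  }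
  where
  open Graph G
  open _≅_

-- An equivalence relation on the set V(G).  Decidability is no restriction
-- classically; it is what lets the multiplicities below be computed.
record VertexEquivalence (G : Graph) : Set₁ where
  open Graph G
  infix 4 _∼_
  field
    _∼_              : Rel V.Carrier 0ℓ
    ≈⇒∼              : V._≈_ ⇒ _∼_
    isDecEquivalence : IsDecEquivalence _∼_

  open IsDecEquivalence isDecEquivalence public
    using (isEquivalence) renaming (_≟_ to _∼?_)

  Classes : Setoid 0ℓ 0ℓ
  Classes = record { isEquivalence = isEquivalence }

module _ {G : Graph} (fin : FiniteGraph G) (ρ : VertexEquivalence G) where
  open Graph G
  open FiniteGraph fin
  open VertexEquivalence ρ
  private
    module Vᶠ = Enumerated V-finite
    module Eᶠ = Enumerated E-finite

  -- Classes are given by representatives c, d.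
  edgesInto : (p d : V.Carrier) → ℕ
  edgesInto p d = length (filter (λ e → (src e Vᶠ.≟ p) ×-dec (tgt e ∼? d)) Eᶠ.elements)

  multiplicity : (c d : V.Carrier) → ℕ
  multiplicity c d = max 0 (map (λ p → edgesInto p d) (filter (_∼? c) Vᶠ.elements))

  -- Edges (c , d , i) with i < multiplicity c d, where c and d are taken up
  -- to ∼ and i is compared by its value (multiplicity respects ∼).
  Quotient : Graph
  Quotient = record
    { V = Classes
    ; E = On.setoid {B = ∃ λ c → ∃ λ d → Fin (multiplicity c d)}
            (Classes ×ₛ (Classes ×ₛ ≡.setoid ℕ))
            (λ (c , d , i) → c , d , toℕ i)
    ; s = record { to = λ (c , _ , _) → c ; cong = proj₁ }
    ; t = record { to = λ (_ , d , _) → d ; cong = λ (_ , eq , _) → eq }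
    }

  IsCongruence : ℕ → Set
  IsCongruence k = IsOut k Quotient

record Automaton (k : ℕ) : Set₁ where
  field
    State  : Setoid 0ℓ 0ℓ
  open Setoid State public
  field
    δ      : Carrier → Fin k → Carrier
    δ-cong : ∀ {u v} a → u ≈ v → δ u a ≈ δ v a

  infixl 7 _·_
  infix 4 _∈V·_

  _·_ : Carrier → List (Fin k) → Carrier
  v · []      = v
  v · (a ∷ w) = δ v a · w

  _∈V·_ : Carrier → List (Fin k) → Set
  q ∈V· w = ∃ λ v → v · w ≈ q

Synchronizing : ∀ {k} → Automaton k → Set
Synchronizing A = ∃ λ w → ∃! _≈_ (_∈V· w)
  where open Automaton A

record Coloring (k : ℕ) (G : Graph) : Set where
  open Graph G
  field
    color : Func E (FinSetoid k)

  χ : E.Carrier → Fin k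
  χ = Func.to color

  field
    bijective : ∀ v → Bijective (Setoid._≈_ (Out v)) _≡_ (λ e → χ (proj₁ e))

  edge : V.Carrier → Fin k → E.Carrier
  edge v a = proj₁ (proj₁ (proj₂ (bijective v) a))

  edge-src : ∀ v a → src (edge v a) V.≈ v
  edge-src v a = proj₂ (proj₁ (proj₂ (bijective v) a))

  edge-χ : ∀ v a → χ (edge v a) ≡ a
  edge-χ v a = proj₂ (proj₂ (bijective v) a) {edge v a , edge-src v a} E.refl

  automaton : Automaton k
  automaton = record
    { State  = V
    ; δ      = λ v a → tgt (edge v a)
    ; δ-cong = λ {u} {v} a u≈v → tgt-cong
        (proj₁ (bijective v)
          {edge u a , V.trans (edge-src u a) u≈v} {edge v a , edge-src v a}
          (≡.trans (edge-χ u a) (≡.sym (edge-χ v a))))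
    }

TotallySynchronizing : ℕ → Graph → Set
TotallySynchronizing k G = (χ : Coloring k G) → Synchronizing (Coloring.automaton χ)

-- Number the vertices and color the edges of Γ, so that Γ becomes the graph of a transition
-- function on Fin n, and let g assign to each vertex an element of H so that the values
-- generate H.  Lift Γ ♯ to an H-cover: over each vertex i sit H × {0, …, top i}, every edge of
-- Γ lands on level 0 with the same group element, and the added loop runs down through the
-- levels and returns from level 0 to the top while multiplying by g i on the right.  Forgetting
-- level and group element is the congruence.  H acts freely by left multiplication and
-- preserves a coloring, which is therefore not synchronizing.
--
-- Conversely, vertices above level 0 are those of in-degree one, so an automorphism preserves
-- the level, and hence, the heights top i being distinct, also i.  Moreover all edges from a
-- given vertex to vertices of the same level and base have the same target.  An automorphism
-- agreeing with a translation at one vertex thus agrees with it along every path.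
module Submission where

open import Defs
open import Algebra.Bundles using (Group; RawGroup)
open import Algebra.Core using (Op₁; Op₂)
open import Algebra.Morphism.Construct.Composition using (isGroupIsomorphism)
import Algebra.Morphism.GroupMonomorphism as GroupMonomorphism
open import Algebra.Morphism.Structures using (module GroupMorphisms)
import Algebra.Properties.Group as GroupProperties
import Algebra.Properties.Monoid.Mult as Mult
open import Algebra.Structures using (IsGroup)
open import Data.Empty using (⊥-elim)
open import Data.Fin.Base using (Fin; zero; suc; toℕ; cast; fromℕ; inject₁; fromℕ<; inject≤)
open import Data.Fin.Induction using (<-weakInduction; >-weakInduction)
open import Data.Fin.Properties
  using (+↔⊎; *↔×; toℕ-injective; toℕ-cast; cast-is-id; toℕ-fromℕ; toℕ-inject₁; pigeonhole;
    0≢1+n; toℕ≤pred[n]; toℕ-fromℕ<; toℕ-inject≤; toℕ<n)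
  renaming (_≟_ to _≟ᶠ_; suc-injective to Fin-suc-injective)
open import Data.Fin.Relation.Unary.Top using (view; ‵fromℕ; ‵inject₁)
open import Data.List.Base using (List; []; _∷_; map; filter; length; allFin; lookup)
open import Data.List.Extrema.Nat using (max; max≤v⁺; v≤max⁺)
open import Data.List.Membership.Propositional using (_∈_; lose)
open import Data.List.Membership.Propositional.Properties
  using (∈-map⁺; ∈-map⁻; ∈-filter⁺; ∈-filter⁻; ∈-allFin; ∈-lookup)
open import Data.List.Membership.Propositional.Properties.WithK using (unique∧set⇒bag)
open import Data.List.Properties using (length-map)
open import Data.List.Relation.Binary.BagAndSetEquality using (∼bag⇒↭)
open import Data.List.Relation.Binary.Permutation.Propositional.Properties using (↭-length)
import Data.List.Relation.Unary.All as All
open import Data.List.Relation.Unary.AllPairs using ([]; _∷_)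
open import Data.List.Relation.Unary.Any using (index)
open import Data.List.Relation.Unary.Any.Properties using (lookup-index)
open import Data.List.Relation.Unary.Unique.Propositional using (Unique)
open import Data.List.Relation.Unary.Unique.Propositional.Properties
  using ()
  renaming (map⁺ to Unique-map⁺; allFin⁺ to Unique-allFin⁺; filter⁺ to Unique-filter⁺)
open import Data.Nat.Base using (ℕ; zero; suc; _+_; _*_; _≤_; z≤n; _<_; s≤s)
open import Data.Nat.Properties
  using (≤-antisym; ≤-reflexive; ≤-trans; ≤-<-trans; m≤n⇒∃[o]m+o≡n; suc-injective; 1+n≢0;
    n≤0⇒n≡0; _<?_; +-suc)
  renaming (_≟_ to _≟ⁿ_)
open import Data.Product using (Σ; ∃; _×_; _,_; proj₁; proj₂; uncurry; ∃₂; map₂)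
open import Data.Product.Function.NonDependent.Propositional using (_×-↔_)
open import Data.Sum.Base using (_⊎_; inj₁; inj₂)
open import Data.Sum.Function.Propositional using (_⊎-↔_)
open import Data.Sum.Function.Setoid using (_⊎-inverse_)
open import Data.Sum.Relation.Binary.Pointwise using (inj₁; inj₂; Pointwise-≡↔≡)
open import Function.Base using (_∘_)
open import Function.Bundles using (Inverse; _↔_; mk↔ₛ′; mk⇔)
import Function.Construct.Composition as Comp
open import Function.Properties.Bijection using (Bijection⇒Inverse)
open import Function.Properties.Inverse using (↔-refl; ↔-sym; ↔-trans)
open import Level using (0ℓ)
open import Relation.Binary.Bundles using (Setoid)
import Relation.Binary.Construct.On as On
open import Relation.Binary.PropositionalEquality as ≡
  using (_≡_; refl; sym; trans; cong; cong₂; subst; _≢_)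
open import Relation.Nullary.Decidable using (_×-dec_; yes; no)
open import Relation.Nullary.Negation using (¬_)

-- Finite index types and graphs of transition functions.

Σ-Fin : ∀ {n} (f : Fin n → ℕ) → ∃ λ N → Σ (Fin n) (Fin ∘ f) ↔ Fin N
Σ-Fin {zero}  f = 0 , mk↔ₛ′ (λ ()) (λ ()) (λ ()) (λ ())
Σ-Fin {suc n} f with N , tail ← Σ-Fin (f ∘ suc) =
  f zero + N , ↔-trans uncons (↔-trans (↔-refl ⊎-↔ tail) (↔-sym +↔⊎))
  where
  uncons : Σ (Fin (suc n)) (Fin ∘ f) ↔ (Fin (f zero) ⊎ Σ (Fin n) (Fin ∘ f ∘ suc))
  uncons = mk↔ₛ′
    (λ { (zero , j) → inj₁ j ; (suc i , j) → inj₂ (i , j) })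
    (λ { (inj₁ j) → zero , j ; (inj₂ (i , j)) → suc i , j })
    (λ { (inj₁ _) → refl ; (inj₂ _) → refl })
    (λ { (zero , _) → refl ; (suc _ , _) → refl })

×-Fin : ∀ {A B : Set} {m n} → A ↔ Fin m → B ↔ Fin n → (A × B) ↔ Fin (m * n)
×-Fin f g = ↔-trans (f ×-↔ g) (↔-sym *↔×)

-- Choosing a coloring, every k-out graph on n vertices takes this form with Q = Fin n.
⟦_⟧ : {Q : Set} {k : ℕ} → (Q → Fin k → Q) → Graph
⟦_⟧ {Q} {k} δ = record
  { V = ≡.setoid Q
  ; E = ≡.setoid (Q × Fin k)
  ; s = record { to = proj₁ ; cong = cong proj₁ }
  ; t = record { to = uncurry δ ; cong = cong (uncurry δ) }
  }

module _ {Q : Set} {k : ℕ} (δ : Q → Fin k → Q) where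

  ⟦⟧-finite : ∀ {n} → Q ↔ Fin n → FiniteGraph ⟦ δ ⟧
  ⟦⟧-finite {n} f = record { V-finite = n , f ; E-finite = n * k , ×-Fin f ↔-refl }

  ⟦⟧-out : IsOut k ⟦ δ ⟧
  ⟦⟧-out v = record
    { to        = proj₂ ∘ proj₁
    ; from      = λ a → (v , a) , refl
    ; to-cong   = cong proj₂
    ; from-cong = cong (v ,_)
    ; inverse   = (λ { refl → refl }) , λ { {_ , refl} refl → refl }
    }

  ⟦⟧-coloring : Coloring k ⟦ δ ⟧
  ⟦⟧-coloring = record
    { color     = record { to = proj₂ ; cong = cong proj₂ }
    ; bijective = λ v →
        (λ { {_ , refl} {_ , refl} refl → refl }) ,
        λ a → ((v , a) , refl) , λ { refl → refl }
    }

-- Invariance under graph isomorphism.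

≅⇒IsOut : ∀ {G H k} → G ≅ H → IsOut k H → IsOut k G
≅⇒IsOut {G} {H} φ out v = Comp.inverse out-φ (out (onV v))
  where
  open _≅_ φ
  module G = Graph G
  module H = Graph H
  φ⁻¹ = ≅-sym φ

  out-φ : Inverse (G.Out v) (H.Out (onV v))
  out-φ = record
    { to        = λ (e , p) → onE e , H.V.trans (commutes-s e) (onV-cong p)
    ; from      = λ (e , p) → onE⁻¹ e , G.V.trans (_≅_.commutes-s φ⁻¹ e)
                    (Inverse.inverseʳ φᵥ p)
    ; to-cong   = onE-cong
    ; from-cong = onE⁻¹-cong
    ; inverse   = Inverse.inverseˡ φₑ , Inverse.inverseʳ φₑ
    }

≅⇒StronglyConnected : ∀ {G H} → G ≅ H → StronglyConnected G → StronglyConnected H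
≅⇒StronglyConnected {G} {H} φ conn u v = ends (Inverse.strictlyInverseˡ φᵥ u)
    (Inverse.strictlyInverseˡ φᵥ v) (push (conn (onV⁻¹ u) (onV⁻¹ v)))
  where
  open _≅_ φ
  module G = Graph G
  module H = Graph H

  ends : ∀ {u u′ v v′} → u H.V.≈ u′ → v H.V.≈ v′ → Path H u v → Path H u′ v′
  ends p q (nil r)      = nil (H.V.trans (H.V.sym p) (H.V.trans r q))
  ends p q (cons e r π) = cons e (H.V.trans r p) (ends H.V.refl q π)

  push : ∀ {u v} → Path G u v → Path H (onV u) (onV v)
  push (nil r)      = nil (onV-cong r)
  push (cons e r π) = cons (onE e) (H.V.trans (commutes-s e) (onV-cong r))
    (ends (H.V.sym (commutes-t e)) H.V.refl (push π))

-- Every k-out graph as the graph of a transition function.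

module Transitions (Δ : Graph) {n} (V↔ : HasSize (Graph.V Δ) n) {k} (out : IsOut k Δ) where
  open Graph Δ
  open Inverse V↔ using (strictlyInverseˡ; strictlyInverseʳ)
    renaming (to to #_; from to rep; to-cong to #-cong)

  edge : Fin n → Fin k → E.Carrier
  edge i a = proj₁ (Inverse.from (out (rep i)) a)

  step : Fin n → Fin k → Fin n
  step i a = # tgt (edge i a)

  color : ∀ i e → src e V.≈ rep i → Fin k
  color i e p = Inverse.to (out (rep i)) (e , p)

  -- Equality in `Out` ignores the source proof, so `p` and `q` need no comparison; keeping `i`
  -- apart from `src e` allows matching on `i ≡ j`.
  color-cong : ∀ {i j e f} {p : src e V.≈ rep i} {q : src f V.≈ rep j} →
               i ≡ j → e E.≈ f → color i e p ≡ color j f q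
  color-cong {i} refl e≈f = Inverse.to-cong (out (rep i)) e≈f

  ≅⟦step⟧ : Δ ≅ ⟦ step ⟧
  ≅⟦step⟧ = record
    { φᵥ = V↔
    ; φₑ = record
      { to        = to
      ; from      = uncurry edge
      ; to-cong   = to-cong
      ; from-cong = λ { refl → E.refl }
      ; inverse   = (λ {(i , a)} e≈ → trans (to-cong e≈) (to-edge i a))
                  , (λ { refl → from-to _ })
      }
    ; commutes-s = λ _ → refl
    ; commutes-t = λ e → #-cong (tgt-cong (from-to e))
    }
    where
    to : E.Carrier → Fin n × Fin k
    to e = # src e , color (# src e) e (V.sym (strictlyInverseʳ (src e)))

    to-cong : ∀ {e f} → e E.≈ f → to e ≡ to f
    to-cong e≈f = cong₂ _,_ (#-cong (src-cong e≈f)) (color-cong (#-cong (src-cong e≈f)) e≈f)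

    from-to : ∀ e → uncurry edge (to e) E.≈ e
    from-to e = Inverse.strictlyInverseʳ (out (rep (# src e))) (e , _)

    to-edge : ∀ i a → to (edge i a) ≡ (i , a)
    to-edge i a = cong₂ _,_ #src≡i
      (trans (color-cong #src≡i E.refl) (Inverse.strictlyInverseˡ (out (rep i)) a))
      where
      #src≡i = trans (#-cong (proj₂ (Inverse.from (out (rep i)) a))) (strictlyInverseˡ i)

-- Adding a loop at every vertex.

module _ (Γ : Graph) where
  open Graph Γ

  ♯-finite : FiniteGraph Γ → FiniteGraph (Γ ♯)
  ♯-finite fin = record
    { V-finite = V-finite
    ; E-finite = _ , Comp.inverse (proj₂ E-finite ⊎-inverse proj₂ V-finite)
        (Comp.inverse (Pointwise-≡↔≡ _ _) (↔-sym +↔⊎))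
    }
    where open FiniteGraph fin

  ♯-stronglyConnected : StronglyConnected Γ → StronglyConnected (Γ ♯)
  ♯-stronglyConnected conn u v = lift (conn u v)
    where
    lift : ∀ {u v} → Path Γ u v → Path (Γ ♯) u v
    lift (nil p)      = nil p
    lift (cons e p π) = cons (inj₁ e) p (lift π)

  ♯-out : ∀ {k} → IsOut k Γ → IsOut (suc k) (Γ ♯)
  ♯-out {k} out v = record
    { to        = to
    ; from      = from
    ; to-cong   = λ { {inj₁ _ , _} {inj₁ _ , _} (inj₁ e≈f) → cong suc (Inverse.to-cong (out v) e≈f)
                    ; {inj₂ _ , _} {inj₂ _ , _} (inj₂ _)   → refl }
    ; from-cong = λ { {a} refl → Setoid.refl (Graph.Out (Γ ♯) v) {from a} }
    ; inverse   = (λ { {zero}  {inj₂ _ , _} (inj₂ _) → refl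
                     ; {suc a} {inj₁ e , p} (inj₁ e≈) → cong suc (Inverse.inverseˡ (out v) {a} {e , p} e≈) })
                , (λ { {inj₁ e , p} refl → inj₁ (Inverse.strictlyInverseʳ (out v) (e , p))
                     ; {inj₂ u , p} refl → inj₂ (V.sym p) })
    }
    where
    to : Setoid.Carrier (Graph.Out (Γ ♯) v) → Fin (suc k)
    -- The added loop gets color `zero` and the edges of `Γ` move up by one, the same convention as
    -- in `Lift.δ`.
    to (inj₁ e , p) = suc (Inverse.to (out v) (e , p))
    to (inj₂ u , p) = zero

    from : Fin (suc k) → Setoid.Carrier (Graph.Out (Γ ♯) v)
    from zero    = inj₂ v , V.refl
    from (suc a) = inj₁ (proj₁ (Inverse.from (out v) a)) , proj₂ (Inverse.from (out v) a)

-- Counting edges, and the quotient by the fibres of a covering.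

max-constant : ∀ {A : Set} (f : A → ℕ) {xs x N} → x ∈ xs → (∀ {y} → y ∈ xs → f y ≡ N) →
               max 0 (map f xs) ≡ N
max-constant f {xs} x∈xs f≡N = ≤-antisym
  (max≤v⁺ z≤n (All.tabulate λ y∈ → bound (∈-map⁻ f y∈)))
  (v≤max⁺ 0 (map f xs) (inj₂ (lose (∈-map⁺ f x∈xs) (≤-reflexive (sym (f≡N x∈xs))))))
  where
  bound : ∀ {y} → ∃ (λ x → x ∈ xs × y ≡ f x) → y ≤ _
  bound (_ , x∈ , refl) = ≤-reflexive (f≡N x∈)

lookup-injective : ∀ {A : Set} {xs : List A} → Unique xs → ∀ {i j} →
                   lookup xs i ≡ lookup xs j → i ≡ j
lookup-injective (x∉ ∷ u) {zero}  {zero}  eq = refl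
lookup-injective (x∉ ∷ u) {zero}  {suc j} eq with () ← All.lookup x∉ (∈-lookup j) eq
lookup-injective (x∉ ∷ u) {suc i} {zero}  eq with () ← All.lookup x∉ (∈-lookup i) (sym eq)
lookup-injective (x∉ ∷ u) {suc i} {suc j} eq = cong suc (lookup-injective u eq)

module _ {A : Set} (fin : Finite (≡.setoid A)) where
  private f = proj₂ fin
  open Enumerated fin

  ∈-elements : ∀ x → x ∈ elements
  ∈-elements x = subst (_∈ elements) (Inverse.strictlyInverseʳ f x)
    (∈-map⁺ (Inverse.from f) (∈-allFin (Inverse.to f x)))

  elements-unique : Unique elements
  elements-unique = Unique-map⁺
    (λ eq → trans (sym (Inverse.strictlyInverseˡ f _)) (Inverse.inverseˡ f eq))
    (Unique-allFin⁺ _)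

module Covering
  {P : Set} {n k : ℕ} (δ : P → Fin k → P) (step : Fin n → Fin k → Fin n)
  (fin : FiniteGraph ⟦ δ ⟧)
  (π : P → Fin n) (π-δ : ∀ p a → π (δ p a) ≡ step (π p) a)
  (σ : Fin n → P) (π-σ : ∀ i → π (σ i) ≡ i)
  where
  open FiniteGraph fin

  fibres : VertexEquivalence ⟦ δ ⟧
  fibres = record
    { _∼_              = λ p q → π p ≡ π q
    ; ≈⇒∼              = cong π
    ; isDecEquivalence = On.isDecEquivalence π (≡.isDecEquivalence _≟ᶠ_)
    }

  private
    module Vᶠ = Enumerated V-finite
    module Eᶠ = Enumerated E-finite

  colors : Fin n → Fin n → List (Fin k)
  colors i j = filter (λ a → step i a ≟ᶠ j) (allFin k)

  colors-unique : ∀ i j → Unique (colors i j)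
  colors-unique i j = Unique-filter⁺ (λ a → step i a ≟ᶠ j) (Unique-allFin⁺ k)

  -- The map from `a` to `(p , a)` turns the list of colors into one with the same members as the
  -- filtered edge list. Both are duplicate-free, hence permutations of each other.
  edgesInto≡ : ∀ p d → edgesInto fin fibres p d ≡ length (colors (π p) (π d))
  edgesInto≡ p d = trans
    (↭-length (∼bag⇒↭ (unique∧set⇒bag
      (Unique-filter⁺ into? (elements-unique E-finite))
      (Unique-map⁺ (cong proj₂) (colors-unique (π p) (π d)))
      (mk⇔ ⇒ ⇐))))
    (length-map (p ,_) (colors (π p) (π d)))
    where
    into? = λ e → (proj₁ e Vᶠ.≟ p) ×-dec (VertexEquivalence._∼?_ fibres (uncurry δ e) d)

    ⇒ : ∀ {e} → e ∈ filter into? Eᶠ.elements → e ∈ map (p ,_) (colors (π p) (π d))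
    ⇒ {_ , a} e∈ with _ , refl , eq ← ∈-filter⁻ into? {xs = Eᶠ.elements} e∈ =
      ∈-map⁺ (p ,_) (∈-filter⁺ (λ a → step (π p) a ≟ᶠ π d) (∈-allFin a) (trans (sym (π-δ p a)) eq))

    ⇐ : ∀ {e} → e ∈ map (p ,_) (colors (π p) (π d)) → e ∈ filter into? Eᶠ.elements
    ⇐ e∈ with a , a∈ , refl ← ∈-map⁻ (p ,_) e∈ =
      ∈-filter⁺ into? (∈-elements E-finite (p , a))
        (refl , trans (π-δ p a) (proj₂ (∈-filter⁻ (λ a → step (π p) a ≟ᶠ π d) {xs = allFin k} a∈)))

  -- The count depends only on `π p`, so the maximum runs over equal numbers; `c` itself keeps its
  -- class from being empty.
  multiplicity≡ : ∀ c d → multiplicity fin fibres c d ≡ length (colors (π c) (π d))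
  multiplicity≡ c d = max-constant (λ p → edgesInto fin fibres p d)
    (∈-filter⁺ (λ p → π p ≟ᶠ π c) (∈-elements V-finite c) refl)
    λ {p} p∈ → trans (edgesInto≡ p d) (cong (λ i → length (colors i (π d)))
      (proj₂ (∈-filter⁻ (λ p → π p ≟ᶠ π c) {xs = Vᶠ.elements} p∈)))

  -- The length N and its proof are kept variable so that the endpoints can be unified.
  colorAt : ∀ i j {N} → N ≡ length (colors i j) → Fin N → Fin k
  colorAt i j eq x = lookup (colors i j) (cast eq x)

  colorAt-cong : ∀ {i i′ j j′ N N′} (eq : N ≡ length (colors i j)) (eq′ : N′ ≡ length (colors i′ j′))
                 {x x′} → i ≡ i′ → j ≡ j′ → toℕ x ≡ toℕ x′ →
                 colorAt i j eq x ≡ colorAt i′ j′ eq′ x′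
  colorAt-cong {i} {j = j} eq eq′ {x} {x′} refl refl x≡x′ = cong (lookup (colors i j))
    (toℕ-injective (trans (toℕ-cast eq x) (trans x≡x′ (sym (toℕ-cast eq′ x′)))))

  step-colorAt : ∀ i j {N} (eq : N ≡ length (colors i j)) x → step i (colorAt i j eq x) ≡ j
  step-colorAt i j eq x = proj₂ (∈-filter⁻ (λ a → step i a ≟ᶠ j) {xs = allFin k} (∈-lookup (cast eq x)))

  -- From a fixed source a color leads to one target only, so equal colors force `j ≡ j′`;
  -- duplicate-freeness of `colors` then recovers the position.
  colorAt-injective : ∀ {i i′ j j′ N N′} (eq : N ≡ length (colors i j)) (eq′ : N′ ≡ length (colors i′ j′))
                      {x x′} → i ≡ i′ → colorAt i j eq x ≡ colorAt i′ j′ eq′ x′ →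
                      j ≡ j′ × toℕ x ≡ toℕ x′
  colorAt-injective {i} {j = j} {j′} eq eq′ {x} {x′} refl same
    with refl ← trans (sym (step-colorAt i j eq x)) (trans (cong (step i) same) (step-colorAt i j′ eq′ x′)) =
    refl , trans (sym (toℕ-cast eq x)) (trans
      (cong toℕ (lookup-injective (colors-unique i j) {cast eq x} {cast eq′ x′} same)) (toℕ-cast eq′ x′))

  colorAt-surjective : ∀ i j {N} (eq : N ≡ length (colors i j)) a → step i a ≡ j →
                       ∃ λ x → colorAt i j eq x ≡ a
  colorAt-surjective i j refl a step≡j = index a∈ ,
    trans (cong (lookup (colors i j)) (cast-is-id refl (index a∈))) (sym (lookup-index a∈))
    where
    a∈ = ∈-filter⁺ (λ a → step i a ≟ᶠ j) (∈-allFin a) step≡j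

  -- Parallel quotient edges between two classes are matched, by position, with the colors that lead
  -- from one base to the other.
  Quotient≅ : Quotient fin fibres ≅ ⟦ step ⟧
  Quotient≅ = record
    { φᵥ = record
      { to = π ; from = σ ; to-cong = λ eq → eq ; from-cong = cong (π ∘ σ)
      ; inverse = (λ {i} eq → trans eq (π-σ i)) , λ { refl → π-σ _ }
      }
    ; φₑ = Bijection⇒Inverse (record
      { to        = to
      ; cong      = λ {(c , d , _)} {(c′ , d′ , _)} (c≡ , d≡ , x≡) → cong₂ _,_ c≡
          (colorAt-cong (multiplicity≡ c d) (multiplicity≡ c′ d′) c≡ d≡ x≡)
      ; bijective = (λ {(c , d , _)} {(c′ , d′ , _)} eq → cong proj₁ eq ,
            colorAt-injective (multiplicity≡ c d) (multiplicity≡ c′ d′) (cong proj₁ eq) (cong proj₂ eq))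
                  , λ (i , a) → surj i a
      })
    ; commutes-s = λ _ → refl
    ; commutes-t = λ (c , d , x) → step-colorAt (π c) (π d) (multiplicity≡ c d) x
    }
    where
    to : Graph.E.Carrier (Quotient fin fibres) → Fin n × Fin k
    to (c , d , x) = π c , colorAt (π c) (π d) (multiplicity≡ c d) x

    surj : ∀ i a → ∃ λ e → ∀ {e′} → Graph.E._≈_ (Quotient fin fibres) e′ e → to e′ ≡ (i , a)
    surj i a with x , eq ← colorAt-surjective (π (σ i)) (π (σ (step i a))) (multiplicity≡ (σ i) (σ (step i a))) a
                             (trans (cong (λ i → step i a) (π-σ i)) (sym (π-σ (step i a)))) =
      (σ i , σ (step i a) , x) ,
      λ {(c , d , _)} (c≡ , d≡ , x≡) → cong₂ _,_ (trans c≡ (π-σ i))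
        (trans (colorAt-cong (multiplicity≡ c d) (multiplicity≡ _ _) c≡ d≡ x≡) eq)

-- The lifted graph and the action of the group.

-- The loop added at i is unrolled into a cycle through the levels 0, …, top k i.  These
-- heights differ for different i; for k = 0 there is only one i, and no level is added.
top : ℕ → ∀ {n} → Fin n → ℕ
top zero    i = 0
top (suc _) i = suc (toℕ i)

top-zero : ∀ {k n} (i : Fin n) → ¬ Fin k → top k i ≡ 0
top-zero {zero}  i _ = refl
top-zero {suc k} i ¬k = ⊥-elim (¬k zero)

top-suc : ∀ {k n} (i : Fin n) → Fin k → top k i ≡ suc (toℕ i)
top-suc {suc k} i _ = refl

inhabited? : ∀ k → Fin k ⊎ ¬ Fin k
inhabited? zero    = inj₂ λ ()
inhabited? (suc k) = inj₁ zero

module Lift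
  {k n m : ℕ} (step : Fin n → Fin k → Fin n)
  {_∙_ : Op₂ (Fin m)} {ε : Fin m} {_⁻¹ : Op₁ (Fin m)} (isGroup : IsGroup _≡_ _∙_ ε _⁻¹)
  (g : Fin n → Fin m)
  where

  H : Group _ _
  H = record { isGroup = isGroup }

  open Group H using (assoc; identityʳ; identityˡ; inverseˡ; inverseʳ; monoid)
  open GroupProperties H using (∙-cancelˡ; ∙-cancelʳ; inverseʳ-unique; identityʳ-unique; identityˡ-unique; //-rightDividesˡ)

  Type : Set
  Type = Σ (Fin n) λ i → Fin (suc (top k i))

  State : Set
  State = Type × Fin m

  State-finite : Finite (≡.setoid State)
  State-finite = _ , ×-Fin (proj₂ (Σ-Fin (suc ∘ top k))) ↔-refl

  base : State → Fin n
  base ((i , _) , _) = i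

  level : State → ℕ
  level ((_ , j) , _) = toℕ j

  δ : State → Fin (suc k) → State
  δ ((i , _)     , h) (suc b) = (step i b , zero) , h
  δ ((i , zero)  , h) zero    = (i , fromℕ (top k i)) , h ∙ g i
  δ ((i , suc j) , h) zero    = (i , inject₁ j) , h

  G : Graph
  G = ⟦ δ ⟧

  base-δ-zero : ∀ p → base (δ p zero) ≡ base p
  base-δ-zero ((i , zero)  , h) = refl
  base-δ-zero ((i , suc j) , h) = refl

  Type-≡ : ∀ p q → base p ≡ base q → level p ≡ level q → proj₁ p ≡ proj₁ q
  Type-≡ ((i , j) , _) _ refl eq = cong (i ,_) (toℕ-injective eq)

  infixr 6 _▹_
  _▹_ : Fin m → State → State
  a ▹ p = map₂ (a ∙_) p

  -- The case with content is color `zero` at level 0: left multiplication by `a` commutes with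
  -- right multiplication by `g i`.
  δ-▹ : ∀ a p c → δ (a ▹ p) c ≡ a ▹ δ p c
  δ-▹ a ((i , _)     , h) (suc b) = refl
  δ-▹ a ((i , zero)  , h) zero    = cong (_ ,_) (assoc a h (g i))
  δ-▹ a ((i , suc j) , h) zero    = refl

  ▹-identity : ∀ p → ε ▹ p ≡ p
  ▹-identity (x , h) = cong (x ,_) (identityˡ h)

  ▹-∙ : ∀ a b p → a ▹ b ▹ p ≡ (a ∙ b) ▹ p
  ▹-∙ a b (x , h) = cong (x ,_) (sym (assoc a b h))

  translation : Fin m → G ≅ G
  translation a = record
    { φᵥ = record
      { to = a ▹_ ; from = (a ⁻¹) ▹_ ; to-cong = cong (a ▹_) ; from-cong = cong ((a ⁻¹) ▹_)
      ; inverse = (λ { refl → a▹a⁻¹▹ _ }) , (λ { refl → a⁻¹▹a▹ _ })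
      }
    ; φₑ = record
      { to = λ (p , c) → a ▹ p , c ; from = λ (p , c) → (a ⁻¹) ▹ p , c
      ; to-cong = cong _ ; from-cong = cong _
      ; inverse = (λ { refl → cong (_, _) (a▹a⁻¹▹ _) }) , (λ { refl → cong (_, _) (a⁻¹▹a▹ _) })
      }
    ; commutes-s = λ _ → refl
    ; commutes-t = λ (p , c) → δ-▹ a p c
    }
    where
    a▹a⁻¹▹ : ∀ p → a ▹ (a ⁻¹) ▹ p ≡ p
    a▹a⁻¹▹ p = trans (▹-∙ a (a ⁻¹) p) (trans (cong (_▹ p) (inverseʳ a)) (▹-identity p))

    a⁻¹▹a▹ : ∀ p → (a ⁻¹) ▹ a ▹ p ≡ p
    a⁻¹▹a▹ p = trans (▹-∙ (a ⁻¹) a p) (trans (cong (_▹ p) (inverseˡ a)) (▹-identity p))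

  -- The coloring is invariant under H, which acts freely: a reset word would send
  -- everything to a state fixed by H.
  not-totallySynchronizing : ∀ {a} → a ≢ ε → ¬ TotallySynchronizing (suc k) G
  not-totallySynchronizing {a} a≢ε sync with w , q , (v , vw≡q) , unique ← sync (⟦⟧-coloring δ) =
    a≢ε (identityˡ-unique a (proj₂ q) (sym (cong proj₂
      (unique (a ▹ v , trans (·-▹ w v) (cong (a ▹_) vw≡q))))))
    where
    open Automaton (Coloring.automaton (⟦⟧-coloring δ)) using (_·_)

    ·-▹ : ∀ w v → (a ▹ v) · w ≡ a ▹ (v · w)
    ·-▹ []      v = refl
    ·-▹ (c ∷ w) v = trans (cong (_· w) (δ-▹ a v c)) (·-▹ w (δ v c))

  -- Strong connectivity of the lifted graph.

  infixr 5 _∘ᴾ_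
  _∘ᴾ_ : ∀ {u v w} → Path G u v → Path G v w → Path G u w
  nil refl   ∘ᴾ π′ = π′
  cons e p π ∘ᴾ π′ = cons e p (π ∘ᴾ π′)

  descend : ∀ i j h → Path G ((i , j) , h) ((i , zero) , h)
  descend i j h = <-weakInduction (λ j → Path G ((i , j) , h) ((i , zero) , h))
    (nil refl) (λ _ → cons (_ , zero) refl) j

  -- The first edge picks up the factor `g i` and lands on the top level, from which the induction
  -- descends to `j`.
  climb : ∀ i j h → Path G ((i , zero) , h) ((i , j) , h ∙ g i)
  climb i j h = >-weakInduction (λ j → Path G ((i , zero) , h) ((i , j) , h ∙ g i))
    (cons (_ , zero) refl (nil refl)) (λ _ π → π ∘ᴾ cons (_ , zero) refl (nil refl)) j

  lift-path : ∀ {i j} h → Path ⟦ step ⟧ i j → Path G ((i , zero) , h) ((j , zero) , h)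
  lift-path h (nil refl)             = nil refl
  lift-path h (cons (i , b) refl π) = cons (((i , zero) , h) , suc b) refl (lift-path h π)

  open Mult monoid using (×-homo-+) renaming (_×_ to _×ᵐ_)

  -- Paths only run forwards, so inverses have to be reached as powers. Two of the powers with
  -- exponents 0 to `m` coincide, and cancelling gives `suc r ×ᵐ x ≡ ε`.
  inverse-is-power : ∀ x → ∃ λ r → r ×ᵐ x ≡ x ⁻¹
  inverse-is-power x
    with i , j , i<j , same ← pigeonhole (≤-reflexive refl) (λ (i : Fin (suc m)) → toℕ i ×ᵐ x)
    with r , i+r≡j ← m≤n⇒∃[o]m+o≡n i<j =
    r , inverseʳ-unique x (r ×ᵐ x) (identityʳ-unique (toℕ i ×ᵐ x) (suc r ×ᵐ x)
      (trans (sym (×-homo-+ x (toℕ i) (suc r)))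
        (trans (cong (_×ᵐ x) (trans (+-suc (toℕ i) r) i+r≡j)) (sym same))))

  module Connected (conn : StronglyConnected ⟦ step ⟧) where

    -- The quantification over all `i` and `h` makes walks composable, hence the set closed under
    -- products.
    Reachable : Fin m → Set
    Reachable x = ∀ i h → Path G ((i , zero) , h) ((i , zero) , h ∙ x)

    reachable-ε : Reachable ε
    reachable-ε i h = nil (cong (_ ,_) (sym (identityʳ h)))

    reachable-∙ : ∀ {x y} → Reachable x → Reachable y → Reachable (x ∙ y)
    reachable-∙ {x} {y} rx ry i h = rx i h ∘ᴾ ry i (h ∙ x) ∘ᴾ nil (cong (_ ,_) (assoc h x y))

    reachable-power : ∀ {x} → Reachable x → ∀ r → Reachable (r ×ᵐ x)
    reachable-power rx zero    = reachable-ε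
    reachable-power rx (suc r) = reachable-∙ rx (reachable-power rx r)

    -- For a generator `g j`: travel to base `j` with `h` unchanged, go once around the unrolled
    -- loop there, and travel back.
    generated⇒reachable : ∀ {x} → Generated H g x → Reachable x
    generated⇒reachable (gen j) i h = lift-path h (conn i j) ∘ᴾ climb j zero h ∘ᴾ lift-path _ (conn j i)
    generated⇒reachable unit        = reachable-ε
    generated⇒reachable (mul x y)   = reachable-∙ (generated⇒reachable x) (generated⇒reachable y)
    generated⇒reachable (inv {x} y) = subst Reachable (proj₂ (inverse-is-power x))
      (reachable-power (generated⇒reachable y) (proj₁ (inverse-is-power x)))
    generated⇒reachable (resp refl x) = generated⇒reachable x

    stronglyConnected : (∀ x → Generated H g x) → StronglyConnected G
    stronglyConnected generated ((i , j) , h) ((i′ , j′) , h′) =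
      descend i j h ∘ᴾ lift-path h (conn i i′)
      -- The final climb multiplies by `g i′`, so the group coordinate is first brought to
      -- `h′ ∙ (g i′ ⁻¹)`.
      ∘ᴾ generated⇒reachable (generated ((h ⁻¹) ∙ (h′ ∙ (g i′ ⁻¹)))) i′ h
      ∘ᴾ climb i′ j′ _
      ∘ᴾ nil (cong (_ ,_) (trans (cong (_∙ g i′) (trans (sym (assoc h (h ⁻¹) _))
           (trans (cong (_∙ (h′ ∙ (g i′ ⁻¹))) (inverseʳ h)) (identityˡ _))))
           (//-rightDividesˡ (g i′) h′)))

    -- A path from `step j b` back to `j` either has a last edge, which enters `j`, or is empty, and
    -- then `b` leads from `j` to itself.
    in-edge : Fin k → ∀ j → ∃₂ λ i b → step i b ≡ j
    in-edge b j with last (conn (step j b) j)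
      where
      last : ∀ {i} → Path ⟦ step ⟧ i j → i ≡ j ⊎ ∃₂ λ i b → step i b ≡ j
      last (nil eq) = inj₁ eq
      last (cons (i , c) refl π) with last π
      ... | inj₁ eq = inj₂ (i , c , eq)
      ... | inj₂ e  = inj₂ e
    ... | inj₁ eq = j , b , eq
    ... | inj₂ e  = e

    trivial : ¬ Fin k → ∀ i j → i ≡ j
    trivial ¬k i j with conn i j
    ... | nil eq          = eq
    ... | cons (_ , b) _ _ = ⊥-elim (¬k b)

  -- In-edges, levels and targets in the lifted graph.

  predecessor : ∀ q → ∃ λ p → δ p zero ≡ q
  predecessor ((i , j) , h) with view j
  ... | ‵fromℕ     = ((i , zero) , h ∙ (g i ⁻¹)) , cong (_ ,_) (//-rightDividesˡ (g i) h)
  ... | ‵inject₁ j = ((i , suc j) , h) , refl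

  level-suc : ∀ p b → level (δ p (suc b)) ≡ 0
  level-suc ((i , j) , h) b = refl

  inject₁≢fromℕ : ∀ {l} (j : Fin l) → inject₁ j ≢ fromℕ l
  inject₁≢fromℕ (suc j) eq = inject₁≢fromℕ j (Fin-suc-injective eq)

  -- Together with `predecessor` this makes color `zero` a permutation of the states.
  δ-zero-injective : ∀ p q → δ p zero ≡ δ q zero → p ≡ q
  δ-zero-injective ((i , zero)  , h) ((i′ , zero)  , h′) eq with refl ← cong base eq =
    cong (_ ,_) (∙-cancelʳ (g i) h h′ (cong proj₂ eq))
  δ-zero-injective ((i , zero)  , h) ((i′ , suc j) , h′) eq with refl ← cong base eq =
    ⊥-elim (inject₁≢fromℕ j (toℕ-injective (sym (cong level eq))))
  δ-zero-injective ((i , suc j) , h) ((i′ , zero)  , h′) eq with refl ← cong base eq =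
    ⊥-elim (inject₁≢fromℕ j (toℕ-injective (cong level eq)))
  δ-zero-injective ((i , suc j) , h) ((i′ , suc j′) , h′) eq with refl ← cong base eq =
    cong₂ (λ j h → (i , suc j) , h)
      (toℕ-injective (trans (sym (toℕ-inject₁ j)) (trans (cong level eq) (toℕ-inject₁ j′))))
      (cong proj₂ eq)

  -- Edges of color `suc b` end on level 0, and color `zero` is injective.
  unique-in-edge : ∀ e f → Graph.tgt G e ≡ Graph.tgt G f → level (Graph.tgt G e) ≢ 0 → e ≡ f
  unique-in-edge (p , zero)  (q , zero)  eq _  = cong (_, zero) (δ-zero-injective p q eq)
  unique-in-edge (p , zero)  (q , suc b) eq l≢0 = ⊥-elim (l≢0 (trans (cong level eq) (level-suc q b)))
  unique-in-edge (p , suc b) f           eq l≢0 = ⊥-elim (l≢0 (level-suc p b))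

  level-δ-zero : ∀ p {l} → level p ≡ suc l → level (δ p zero) ≡ l
  level-δ-zero ((i , suc j) , h) eq = trans (toℕ-inject₁ j) (suc-injective eq)

  level-δ-top : ∀ p → level p ≡ 0 → level (δ p zero) ≡ top k (base p)
  level-δ-top ((i , zero) , h) _ = toℕ-fromℕ _

  level-δ-< : ∀ p c → level p ≢ 0 → level (δ p c) < level p
  level-δ-< ((i , zero)  , h) c       l≢0 = ⊥-elim (l≢0 refl)
  level-δ-< ((i , suc j) , h) zero    _   = ≤-reflexive (cong suc (toℕ-inject₁ j))
  level-δ-< ((i , suc j) , h) (suc b) _   = s≤s z≤n

  -- The group coordinate changes only on the edge of color `zero` leaving level 0. Once some color
  -- `suc b` exists, that edge ends above level 0, while those of color `suc b` end on level 0.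
  δ-determined-by-type : ∀ p c c′ → proj₁ (δ p c) ≡ proj₁ (δ p c′) → δ p c ≡ δ p c′
  δ-determined-by-type p zero zero eq = refl
  δ-determined-by-type ((i , j) , h) (suc b) (suc b′) eq = cong (_, h) eq
  δ-determined-by-type ((i , suc j) , h) zero (suc b) eq = cong (_, h) eq
  δ-determined-by-type ((i , suc j) , h) (suc b) zero eq = cong (_, h) eq
  δ-determined-by-type ((i , zero) , h) zero (suc b) eq =
    ⊥-elim (1+n≢0 (trans (sym (trans (toℕ-fromℕ _) (top-suc i b))) (cong (λ x → level (x , h)) eq)))
  δ-determined-by-type ((i , zero) , h) (suc b) zero eq =
    ⊥-elim (1+n≢0 (trans (sym (trans (toℕ-fromℕ _) (top-suc i b))) (cong (λ x → level (x , h)) (sym eq))))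

  image-edge : ∀ (φ : G ≅ G) p c → ∃ λ c′ → δ (_≅_.onV φ p) c′ ≡ _≅_.onV φ (δ p c)
  image-edge φ p c = proj₂ (onE (p , c)) ,
    trans (cong (λ q → δ q (proj₂ (onE (p , c)))) (sym (commutes-s (p , c)))) (commutes-t (p , c))
    where open _≅_ φ

  -- Automorphisms preserve types and are translations on vertices.

  module Rigidity (conn : StronglyConnected ⟦ step ⟧) where
    open Connected conn

    module WithColor (b₀ : Fin k) where

      -- Only level 0 has in-degree greater than one.
      nonzero-preserved : ∀ (φ : G ≅ G) p → level p ≢ 0 → level (_≅_.onV φ p) ≢ 0
      nonzero-preserved φ p l≢0 fl≡0 = 0≢1+n (cong proj₂ e≡f)
        where
        open _≅_ φ
        q : State
        q = onV p

        i = proj₁ (in-edge b₀ (base q))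
        b = proj₁ (proj₂ (in-edge b₀ (base q)))

        -- If `q` lies on level 0, both the loop edge `e` and the lifted edge `f` enter it. Pulled
        -- back, they enter `p` above level 0 and must coincide, although their colors differ.
        e f : State × Fin (suc k)
        e = proj₁ (predecessor q) , zero
        f = ((i , zero) , proj₂ q) , suc b

        f-tgt : Graph.tgt G f ≡ q
        f-tgt = cong (_, proj₂ q)
          (Type-≡ (Graph.tgt G f) q (proj₂ (proj₂ (in-edge b₀ (base q)))) (sym fl≡0))

        pulled : ∀ x → Graph.tgt G x ≡ q → Graph.tgt G (onE⁻¹ x) ≡ p
        pulled x eq = trans (_≅_.commutes-t (≅-sym φ) x)
          (trans (cong onV⁻¹ eq) (Inverse.strictlyInverseʳ φᵥ p))

        e-tgt : Graph.tgt G e ≡ q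
        e-tgt = proj₂ (predecessor q)

        e≡f : e ≡ f
        e≡f = trans (sym (Inverse.strictlyInverseˡ φₑ e)) (trans (cong onE
          (unique-in-edge (onE⁻¹ e) (onE⁻¹ f) (trans (pulled e e-tgt) (sym (pulled f f-tgt)))
            (l≢0 ∘ trans (cong level (sym (pulled e e-tgt))))))
          (Inverse.strictlyInverseˡ φₑ f))

      -- Each descent along color `zero` is mapped to an edge leaving a vertex above level 0, and
      -- such an edge strictly lowers the level.
      level-increases : ∀ (φ : G ≅ G) l p → level p ≡ l → l ≤ level (_≅_.onV φ p)
      level-increases φ zero    p eq = z≤n
      level-increases φ (suc l) p eq with c′ , edge ← image-edge φ p zero =
        ≤-<-trans (≤-trans (level-increases φ l (δ p zero) (level-δ-zero p eq))
                           (≤-reflexive (cong level (sym edge))))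
          (level-δ-< _ c′ (nonzero-preserved φ p λ l≡0 → 1+n≢0 (trans (sym eq) l≡0)))

      level-preserved : ∀ (φ : G ≅ G) p → level (_≅_.onV φ p) ≡ level p
      level-preserved φ p = ≤-antisym
        (≤-trans (level-increases (≅-sym φ) _ (_≅_.onV φ p) refl)
          (≤-reflexive (cong level (Inverse.strictlyInverseʳ (_≅_.φᵥ φ) p))))
        (level-increases φ _ p refl)

      -- As levels are preserved, the image edge ends above level 0, which leaves only color `zero`.
      image-δ-zero : ∀ (φ : G ≅ G) p → level (δ p zero) ≢ 0 →
                     δ (_≅_.onV φ p) zero ≡ _≅_.onV φ (δ p zero)
      image-δ-zero φ p l≢0 with image-edge φ p zero
      ... | zero  , edge = edge
      ... | suc b , edge = ⊥-elim (l≢0 (trans (sym (level-preserved φ (δ p zero)))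
                             (trans (cong level (sym edge)) (level-suc (_≅_.onV φ p) b))))

      -- From level 0 the cycle jumps to the top level, whose height encodes the base.
      base-preserved-at-zero : ∀ (φ : G ≅ G) p → level p ≡ 0 → base (_≅_.onV φ p) ≡ base p
      base-preserved-at-zero φ p l≡0 = toℕ-injective (suc-injective (begin
        suc (toℕ (base (onV p)))  ≡⟨ top-suc (base (onV p)) b₀ ⟨
        top k (base (onV p))      ≡⟨ level-δ-top (onV p) (trans (level-preserved φ p) l≡0) ⟨
        level (δ (onV p) zero)    ≡⟨ cong level (image-δ-zero φ p λ l≡0′ → 1+n≢0 (trans (sym top≡) l≡0′)) ⟩
        level (onV (δ p zero))    ≡⟨ level-preserved φ (δ p zero) ⟩
        level (δ p zero)          ≡⟨ top≡ ⟩
        suc (toℕ (base p))        ∎))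
        where
        open _≅_ φ
        open ≡.≡-Reasoning
        top≡ = trans (level-δ-top p l≡0) (top-suc (base p) b₀)

      base-preserved-δ-zero : ∀ (φ : G ≅ G) p → base (_≅_.onV φ p) ≡ base p →
                              base (_≅_.onV φ (δ p zero)) ≡ base (δ p zero)
      base-preserved-δ-zero φ p same with level (δ p zero) ≟ⁿ 0
      ... | yes l≡0 = base-preserved-at-zero φ (δ p zero) l≡0
      ... | no  l≢0 = trans (cong base (sym (image-δ-zero φ p l≢0)))
        (trans (base-δ-zero (_≅_.onV φ p)) (trans same (sym (base-δ-zero p))))

      base-preserved : ∀ (φ : G ≅ G) p → base (_≅_.onV φ p) ≡ base p
      base-preserved φ ((i , j) , h) =
        >-weakInduction (λ j → ∀ h → base (_≅_.onV φ ((i , j) , h)) ≡ i)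
          -- The top level is entered by color `zero` from level 0, where the base is already known;
          -- `h` is rewritten as `(h ∙ (g i ⁻¹)) ∙ g i` to exhibit that edge.
          (λ h → subst (λ h → base (_≅_.onV φ ((i , fromℕ (top k i)) , h)) ≡ i)
            (//-rightDividesˡ (g i) h)
            (base-preserved-δ-zero φ ((i , zero) , h ∙ (g i ⁻¹)) (base-preserved-at-zero φ _ refl)))
          (λ j ih h → base-preserved-δ-zero φ ((i , suc j) , h) (ih h))
          j h

    type-preserved : ∀ (φ : G ≅ G) p → proj₁ (_≅_.onV φ p) ≡ proj₁ p
    type-preserved φ p with inhabited? k
    ... | inj₁ b₀ = Type-≡ (_≅_.onV φ p) p (base-preserved φ p) (level-preserved φ p)
      where open WithColor b₀
    -- Without colors there are no edges to connect distinct bases, so there is one base, and its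
    -- only level is 0.
    ... | inj₂ ¬k = Type-≡ (_≅_.onV φ p) p (trivial ¬k _ _)
                      (trans (level≡0 (_≅_.onV φ p)) (sym (level≡0 p)))
      where
      level≡0 : ∀ p → level p ≡ 0
      level≡0 ((i , j) , h) = n≤0⇒n≡0 (subst (toℕ j ≤_) (top-zero i ¬k) (toℕ≤pred[n] j))

    module _ (φ : G ≅ G) where
      open _≅_ φ

      translation-propagates : ∀ a {u v} → Path G u v → onV u ≡ a ▹ u → onV v ≡ a ▹ v
      translation-propagates a (nil refl) eq = eq
      translation-propagates a (cons (p , c) refl π) eq = translation-propagates a π (begin
        onV (δ p c)      ≡⟨ edge ⟨
        δ (onV p) c′     ≡⟨ cong (λ q → δ q c′) eq ⟩
        -- `φ` need not keep colors, so `c′` and `c` may differ; the two edges still leave `a ▹ p`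
        -- for the same type.
        δ (a ▹ p) c′     ≡⟨ δ-determined-by-type (a ▹ p) c′ c same-type ⟩
        δ (a ▹ p) c      ≡⟨ δ-▹ a p c ⟩
        a ▹ δ p c        ∎)
        where
        open ≡.≡-Reasoning
        c′ = proj₁ (image-edge φ p c)
        edge = proj₂ (image-edge φ p c)

        same-type : proj₁ (δ (a ▹ p) c′) ≡ proj₁ (δ (a ▹ p) c)
        same-type = begin
          proj₁ (δ (a ▹ p) c′)   ≡⟨ cong (λ q → proj₁ (δ q c′)) eq ⟨
          proj₁ (δ (onV p) c′)   ≡⟨ cong proj₁ edge ⟩
          proj₁ (onV (δ p c))    ≡⟨ type-preserved φ (δ p c) ⟩
          proj₁ (δ p c)          ≡⟨ cong proj₁ (δ-▹ a p c) ⟨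
          proj₁ (δ (a ▹ p) c)    ∎

    -- The automorphism group modulo the automorphisms fixing all vertices.

    module Automorphisms (generated : ∀ x → Generated H g x) (i₀ : Fin n) where

      origin : State
      origin = (i₀ , zero) , ε

      shift : G ≅ G → Fin m
      shift φ = proj₂ (_≅_.onV φ origin)

      -- The factor is read off at `origin`, whose group coordinate is `ε`, and paths from there
      -- reach every state.
      is-translation : ∀ φ p → _≅_.onV φ p ≡ shift φ ▹ p
      is-translation φ p = translation-propagates φ (shift φ)
        (stronglyConnected generated origin p)
        (cong₂ _,_ (type-preserved φ origin) (sym (identityʳ (shift φ))))

      Aut/Aut-E≅H : (Aut G /ᴳ Aut-E G) ≅ᴳ H
      Aut/Aut-E≅H = shift , record
        { isGroupMonomorphism = record
          { isGroupHomomorphism = record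
            { isMonoidHomomorphism = record
              { isMagmaHomomorphism = record
                { isRelHomomorphism = record { cong = λ {φ} {ψ} → shift-cong {φ} {ψ} }
                ; homo = λ φ ψ → cong proj₂ (is-translation φ (_≅_.onV ψ origin))
                }
              ; ε-homo = refl
              }
            ; ⁻¹-homo = λ φ → inverseʳ-unique (shift φ) (shift (≅-sym φ)) (trans
                (cong proj₂ (sym (is-translation φ (_≅_.onV⁻¹ φ origin))))
                (cong proj₂ (Inverse.strictlyInverseˡ (_≅_.φᵥ φ) origin)))
            }
          ; injective = λ {φ} {ψ} same v → begin
              _≅_.onV φ (_≅_.onV⁻¹ ψ v)  ≡⟨ is-translation φ (_≅_.onV⁻¹ ψ v) ⟩
              shift φ ▹ _≅_.onV⁻¹ ψ v    ≡⟨ cong (_▹ _≅_.onV⁻¹ ψ v) same ⟩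
              shift ψ ▹ _≅_.onV⁻¹ ψ v    ≡⟨ is-translation ψ (_≅_.onV⁻¹ ψ v) ⟨
              _≅_.onV ψ (_≅_.onV⁻¹ ψ v)  ≡⟨ Inverse.strictlyInverseˡ (_≅_.φᵥ ψ) v ⟩
              v                          ∎
          }
        ; surjective = λ a → translation a , λ {φ} same → trans
            (shift-cong {φ} {translation a} same) (identityʳ a)
        }
        where
        open ≡.≡-Reasoning

        -- Equality in the quotient says that `φ` after the inverse of `ψ` fixes every vertex; this
        -- is evaluated at the image of `origin` under `ψ`.
        shift-cong : ∀ {φ ψ} → Group._≈_ (Aut G /ᴳ Aut-E G) φ ψ → shift φ ≡ shift ψ
        shift-cong {φ} {ψ} same = cong proj₂ (begin
          _≅_.onV φ origin                                ≡⟨ cong (_≅_.onV φ) (Inverse.strictlyInverseʳ (_≅_.φᵥ ψ) origin) ⟨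
          _≅_.onV φ (_≅_.onV⁻¹ ψ (_≅_.onV ψ origin))     ≡⟨ same (_≅_.onV ψ origin) ⟩
          _≅_.onV ψ origin                                ∎)

-- Moving the group to `Fin m` and placing generators on vertices.

module TransportToFin {c ℓ} (H : Group c ℓ) {m} (size : HasSize (Group.setoid H) m) where
  private module H = Group H
  open Inverse size using (to; from; to-cong; from-cong; inverseˡ; strictlyInverseˡ; strictlyInverseʳ)

  rawGroup : RawGroup 0ℓ 0ℓ
  rawGroup = record
    { Carrier = Fin m
    ; _≈_ = _≡_
    ; _∙_ = λ x y → to (from x H.∙ from y)
    ; ε   = to H.ε
    ; _⁻¹ = λ x → to (from x H.⁻¹)
    }

  open GroupMorphisms rawGroup H.rawGroup

  from-isGroupIsomorphism : IsGroupIsomorphism from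
  from-isGroupIsomorphism = record
    { isGroupMonomorphism = record
      { isGroupHomomorphism = record
        { isMonoidHomomorphism = record
          { isMagmaHomomorphism = record
            { isRelHomomorphism = record { cong = from-cong }
            ; homo = λ _ _ → strictlyInverseʳ _
            }
          ; ε-homo = strictlyInverseʳ _
          }
        ; ⁻¹-homo = λ _ → strictlyInverseʳ _
        }
      ; injective = λ {x} eq → trans (sym (strictlyInverseˡ x)) (inverseˡ eq)
      }
    ; surjective = λ y → to y , λ { refl → strictlyInverseʳ y }
    }

  group : Group 0ℓ 0ℓ
  group = record { isGroup = GroupMonomorphism.isGroup
    (IsGroupIsomorphism.isGroupMonomorphism from-isGroupIsomorphism) H.isGroup }

  -- Each `to (f i)` only has to occur among the values of `g`, so a padded family still generates.
  generated : ∀ {d} {f : Fin d → H.Carrier} {n} {g : Fin n → Fin m} →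
              (∀ i → ∃ λ j → g j ≡ to (f i)) → ∀ {x} → Generated H f x → Generated group g (to x)
  generated {f = f} {g = g} covers (gen i) with j , eq ← covers i = resp eq (gen j)
  generated covers unit = unit
  generated covers (mul x y) = resp (to-cong (H.∙-cong (strictlyInverseʳ _) (strictlyInverseʳ _)))
    (mul (generated covers x) (generated covers y))
  generated covers (inv x) = resp (to-cong (H.⁻¹-cong (strictlyInverseʳ _))) (inv (generated covers x))
  generated covers (resp eq x) = resp (to-cong eq) (generated covers x)

module _ {a} {A : Set a} where

  pad : ∀ {d} → A → (Fin d → A) → ∀ {n} → Fin n → A
  pad {d} default f i with toℕ i <? d
  ... | yes i<d = f (fromℕ< i<d)
  ... | no  _   = default

  pad-inject≤ : ∀ {d} default (f : Fin d → A) {n} (d≤n : d ≤ n) i → pad default f (inject≤ i d≤n) ≡ f i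
  pad-inject≤ {d} default f d≤n i with toℕ (inject≤ i d≤n) <? d
  ... | yes i<d = cong f (toℕ-injective (trans (toℕ-fromℕ< i<d) (toℕ-inject≤ i d≤n)))
  ... | no  i≮d = ⊥-elim (i≮d (subst (_< d) (sym (toℕ-inject≤ i d≤n)) (toℕ<n i)))

-- With no generators, everything generated equals `ε`. The index obtained gives `Γ` a vertex over
-- which `origin` can be placed.
generators-nonempty : ∀ {c ℓ} (H : Group c ℓ) → Nontrivial H → ∀ {d} (f : Fin d → Group.Carrier H) →
                      (∀ x → Generated H f x) → Fin d
generators-nonempty H _ {suc d} f _ = zero
generators-nonempty H (x , x≉ε) {zero} f all = ⊥-elim (x≉ε (trivial (all x)))
  where
  open Group H using (_≈_; ε; identityˡ; ∙-cong; ⁻¹-cong) renaming (refl to ≈-refl; sym to ≈-sym; trans to ≈-trans)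
  trivial : ∀ {x} → Generated H f x → x ≈ ε
  trivial unit        = ≈-refl
  trivial (mul x y)   = ≈-trans (∙-cong (trivial x) (trivial y)) (identityˡ ε)
  trivial (inv x)     = ≈-trans (⁻¹-cong (trivial x)) (GroupProperties.ε⁻¹≈ε H)
  trivial (resp eq x) = ≈-trans (≈-sym eq) (trivial x)

theorem3p24 : ∀ {c ℓ} (k : ℕ) (Γ : Graph) (Γ-finite : FiniteGraph Γ) →
    StronglyConnected Γ → IsOut k Γ →
    (H : Group c ℓ) → Finite (Group.setoid H) → Nontrivial H →
    (d : ℕ) → IsRank H d → d ≤ FiniteGraph.∣V∣ Γ-finite →
    (FiniteGraph (Γ ♯) × StronglyConnected (Γ ♯) × IsOut (suc k) (Γ ♯)) ×
    (∃ λ (G : Graph) → Σ (FiniteGraph G) λ G-finite →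
    StronglyConnected G × IsOut (suc k) G ×
    (∃ λ (ρ : VertexEquivalence G) →
    IsCongruence G-finite ρ (suc k) × (Quotient G-finite ρ ≅ Γ ♯)) ×
    (Aut G /ᴳ Aut-E G ≅ᴳ H) ×
    ¬ TotallySynchronizing (suc k) G)
theorem3p24 k Γ Γ-finite Γ-conn Γ-out H (m , size) nontrivial@(x , x≉ε) d ((f , _ , f-generates) , _) d≤n =
  (♯-finite Γ Γ-finite , ♯-stronglyConnected Γ Γ-conn , ♯-out Γ Γ-out) ,
  G , G-finite , stronglyConnected generates , ⟦⟧-out δ ,
  -- The congruence property is read off from the isomorphism, as `Γ ♯` is `suc k`-out.
  (fibres , ≅⇒IsOut Quotient≅Γ♯ (♯-out Γ Γ-out) , Quotient≅Γ♯) ,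
  (_ , isGroupIsomorphism (Group.trans H) (proj₂ Aut/Aut-E≅H) from-isGroupIsomorphism) ,
  not-totallySynchronizing {to x} λ tx≡ε → x≉ε (Group.trans H (Group.sym H (strictlyInverseʳ x))
    (Inverse.inverseʳ size tx≡ε))
  where
  open FiniteGraph Γ-finite using (V-finite) renaming (∣V∣ to n)
  open Inverse size using (to; strictlyInverseˡ; strictlyInverseʳ)
  open TransportToFin H size
  module T = Transitions Γ (proj₂ V-finite) Γ-out
  module T♯ = Transitions (Γ ♯) (proj₂ V-finite) (♯-out Γ Γ-out)

  g : Fin n → Fin m
  -- The first `d` vertices carry the generators and the others the unit; by `d≤n` every generator
  -- finds a place.
  g = pad (to (Group.ε H)) (to ∘ f)

  generates : ∀ y → Generated group g y
  generates y = subst (Generated group g) (strictlyInverseˡ y)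
    (generated (λ i → inject≤ i d≤n , pad-inject≤ _ (to ∘ f) d≤n i) (f-generates (Inverse.from size y)))

  i₀ : Fin n
  i₀ = inject≤ (generators-nonempty H nontrivial f f-generates) d≤n

  open Lift T.step (Group.isGroup group) g hiding (H)
  step-conn = ≅⇒StronglyConnected T.≅⟦step⟧ Γ-conn
  open Connected step-conn using (stronglyConnected)
  open Rigidity step-conn
  open Automorphisms generates i₀ using (Aut/Aut-E≅H)

  G-finite = ⟦⟧-finite δ (proj₂ State-finite)

  base-δ : ∀ p c → base (δ p c) ≡ T♯.step (base p) c
  base-δ p zero    = trans (base-δ-zero p) (sym (Inverse.strictlyInverseˡ (proj₂ V-finite) (base p)))
  base-δ p (suc b) = refl

  open Covering δ T♯.step G-finite base base-δ (λ i → (i , zero) , to (Group.ε H)) (λ _ → refl)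

  Quotient≅Γ♯ : Quotient G-finite fibres ≅ Γ ♯
  Quotient≅Γ♯ = ≅-trans Quotient≅ (≅-sym T♯.≅⟦step⟧)
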